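{- Let $n$ and $k$ be integers with $3\le k\le n-1$, and let $CT\in\mathcal{CT}_{n,k}$. Then \[ M_1(CT)\le\begin{cases}4n+2k-10 & \text{if } k\equiv 0 \pmod 3,\\ 4n+2k-8 & \text{if } k\equiv 1 \pmod 3,\\ 4n+2k-12 & \text{if } k\equiv 2 \pmod 3.\end{cases} \] Equality holds if and only if $CT$ contains exactly one vertex of degree $3$ when $k\equiv 0 \pmod 3$, no vertex of degree $3$ when $k\equiv 1\pmod 3$, and exactly two vertices of degree $3$ when $k\equiv 2\pmod 3$.
   Context: All graphs are simple and connected. A chemical tree is a tree with maximum degree at most $4$. $d_v$ denotes the degree of a vertex $v$. A vertex of degree $1$ is pendent; a vertex of degree greater than $2$ is branching. A segment of a tree $T$ is a path of positive length in $T$ neither of whose end vertices has degree $2$ and all of whose internal vertices (if any) have degree $2$. $\mathcal{CT}_{n,k}$ denotes the class of all $n$-vertex chemical trees having exactly $k$ segments. The first Zagreb index is $M_1(G)=\sum_{v\in V(G)}d_v^2$. -}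

module Defs where

open import Data.Fin using (Fin)
open import Data.List using (List; []; _∷_; _∷ʳ_; map; filter; length; allFin; reverse)
open import Data.List.Properties using (reverse-involutive)
open import Data.List.Relation.Unary.All using (All)
open import Data.List.Relation.Unary.Linked using (Linked)
open import Data.List.Relation.Unary.Unique.Propositional using (Unique)
open import Data.Nat using (ℕ; _≤_; _^_; _≟_)
open import Data.Nat.ListAction using (sum)
open import Data.Product using (_×_)
open import Data.Sum using (_⊎_; inj₁; inj₂)
open import Function.Bundles using (Inverse)
open import Level using (0ℓ)
open import Relation.Binary.Bundles using (Setoid)
open import Relation.Binary.Construct.Closure.ReflexiveTransitive using (Star)
open import Relation.Binary.Core using (Rel)
open import Relation.Binary.Definitions using (Decidable; Symmetric; Irreflexive)
open import Relation.Binary.PropositionalEquality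
  using (_≡_; _≢_; refl; sym; trans; cong; setoid)
open import Relation.Nullary using (¬_)

record Graph (n : ℕ) : Set₁ where
  infix 4 _~_ _~?_
  field
    _~_      : Rel (Fin n) 0ℓ
    _~?_     : Decidable _~_
    ~-sym    : Symmetric _~_
    ~-irrefl : Irreflexive _≡_ _~_

module _ {n : ℕ} (G : Graph n) where
  open Graph G

  degree : Fin n → ℕ
  degree v = length (filter (v ~?_) (allFin n))

  M₁ : ℕ
  M₁ = sum (map (λ v → degree v ^ 2) (allFin n))

  numDegree : ℕ → ℕ
  numDegree d = length (filter (λ v → degree v ≟ d) (allFin n))

  IsPath : List (Fin n) → Set
  IsPath vs = Linked _~_ vs × Unique vs

  Connected : Set
  Connected = ∀ u v → Star _~_ u v

  -- The cycle visits v ∷ vs in order and then returns to v; the length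
  -- condition excludes going back and forth along a single edge.
  IsCycle : Fin n → List (Fin n) → Set
  IsCycle v vs = 2 ≤ length vs × Unique (v ∷ vs) × Linked _~_ (v ∷ (vs ∷ʳ v))

  Acyclic : Set
  Acyclic = ∀ v vs → ¬ IsCycle v vs

  record IsTree : Set where
    field
      connected : Connected
      acyclic   : Acyclic

  record IsChemicalTree : Set where
    field
      isTree   : IsTree
      degree≤4 : ∀ v → degree v ≤ 4

  -- A segment traversed in one of its two directions.  Its length is
  -- positive because the start and the end are separate entries of a
  -- repetition-free list.
  record Segment : Set where
    field
      start    : Fin n
      internal : List (Fin n)
      end      : Fin n

    vertices : List (Fin n)
    vertices = start ∷ (internal ∷ʳ end)

    field
      isPath     : IsPath vertices
      start≢2    : degree start ≢ 2
      end≢2      : degree end ≢ 2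
      internal≡2 : All (λ v → degree v ≡ 2) internal

  open Segment using (vertices)

  -- A segment is a subgraph, so a path and its reversal are the same segment.
  infix 4 _≈ˢ_
  _≈ˢ_ : Rel Segment 0ℓ
  S ≈ˢ S′ = vertices S ≡ vertices S′ ⊎ vertices S ≡ reverse (vertices S′)

  private
    flip-reverse : {xs ys : List (Fin n)} → xs ≡ reverse ys → ys ≡ reverse xs
    flip-reverse {ys = ys} p = trans (sym (reverse-involutive ys)) (cong reverse (sym p))

    ≈ˢ-sym : ∀ {S S′} → S ≈ˢ S′ → S′ ≈ˢ S
    ≈ˢ-sym (inj₁ p) = inj₁ (sym p)
    ≈ˢ-sym (inj₂ p) = inj₂ (flip-reverse p)

    ≈ˢ-trans : ∀ {S S′ S″} → S ≈ˢ S′ → S′ ≈ˢ S″ → S ≈ˢ S″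
    ≈ˢ-trans (inj₁ p) (inj₁ q) = inj₁ (trans p q)
    ≈ˢ-trans (inj₁ p) (inj₂ q) = inj₂ (trans p q)
    ≈ˢ-trans (inj₂ p) (inj₁ q) = inj₂ (trans p (cong reverse q))
    ≈ˢ-trans (inj₂ p) (inj₂ q) = inj₁ (trans p (sym (flip-reverse q)))

  segmentSetoid : Setoid 0ℓ 0ℓ
  segmentSetoid = record
    { Carrier       = Segment
    ; _≈_           = _≈ˢ_
    ; isEquivalence = record
      { refl  = inj₁ refl
      ; sym   = λ {S} {S′} → ≈ˢ-sym {S} {S′}
      ; trans = λ {S} {S′} {S″} → ≈ˢ-trans {S} {S′} {S″}
      }
    }

  HasSegments : ℕ → Set
  HasSegments k = Inverse (setoid (Fin k)) segmentSetoid

-- The class of n-vertex chemical trees with exactly k segments.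
record CT (n k : ℕ) : Set₁ where
  field
    graph          : Graph n
    isChemicalTree : IsChemicalTree graph
    hasSegments    : HasSegments graph k

{-# OPTIONS --safe #-}
module Submission where

open import Defs
open import Data.Bool using (true; false; if_then_else_)
open import Data.Empty using (⊥-elim)
open import Data.Fin using (Fin; zero; suc)
import Data.Fin as Fin
import Data.Fin.Properties as Fin
open import Data.List
  using (List; []; _∷_; _∷ʳ_; _++_; map; filter; length; allFin; reverse; cartesianProduct)
open import Data.List.Membership.Propositional using (_∈_; _∉_)
open import Data.List.Membership.Propositional.Properties
  using (∈-map⁺; ∈-map⁻; ∈-filter⁺; ∈-filter⁻; ∈-allFin; ∈-cartesianProduct⁺)
open import Data.List.Membership.Propositional.Properties.WithK using (unique∧set⇒bag)
open import Data.List.Properties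
  using ( length-map; length-++; length-filter; length-tabulate; filter-++; filter-none; filter-≐
        ; map-cong; reverse-++; unfold-reverse; reverse-involutive; reverse-injective
        ; ∷-injectiveˡ )
open import Data.List.Relation.Binary.BagAndSetEquality using (∼bag⇒↭)
open import Data.List.Relation.Binary.Permutation.Propositional using (↭-sym; ↭⇒↭ₛ)
open import Data.List.Relation.Binary.Permutation.Propositional.Properties
  using (↭-length; ↭-reverse; All-resp-↭)
open import Data.List.Relation.Binary.Permutation.Setoid.Properties using (Unique-resp-↭)
open import Data.List.Relation.Unary.All as All using (All; []; _∷_)
open import Data.List.Relation.Unary.All.Properties using (¬Any⇒All¬; All¬⇒¬Any)
open import Data.List.Relation.Unary.AllPairs using ([]; _∷_)
open import Data.List.Relation.Unary.Any using (here; there)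
open import Data.List.Relation.Unary.Linked using (Linked; []; [-]; _∷_)
open import Data.List.Relation.Unary.Unique.Propositional using (Unique)
import Data.List.Relation.Unary.Unique.Propositional.Properties as Unique
open import Data.Nat using (ℕ; zero; suc; _+_; _*_; _∸_; _^_; _≤_; _<_; _≟_; _%_; z≤n; s≤s)
open import Data.Nat.DivMod using ([m+kn]%n≡m%n)
open import Data.Nat.ListAction using (sum)
open import Data.Nat.Properties
  using ( module ≤-Reasoning; ≤-trans; n≮n; m≤m+n; m≤n⇒∃[o]m+o≡n; m+n∸n≡m; m+n≡0⇒m≡0; +-comm
        ; +-identityʳ; +-cancelˡ-≡; +-cancelʳ-≡; *-suc; *-zeroʳ; *-distribˡ-+; *-cancelˡ-≡ )
open import Data.Nat.Tactic.RingSolver using (solve-∀)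
open import Data.Product using (∃₂; ∃-syntax; Σ-syntax; _×_; _,_; proj₁; proj₂)
open import Data.Product.Properties using (,-injectiveˡ; ,-injectiveʳ)
open import Data.Sum using (_⊎_; inj₁; inj₂)
open import Function using (_∘_; case_of_)
open import Function.Bundles using (_⇔_; mk⇔; Inverse)
open import Level using (0ℓ)
open import Relation.Binary.Construct.Closure.ReflexiveTransitive as Star
  using (Star; ε; _◅_; _◅◅_)
open import Relation.Binary.Core using (Rel; _⇒_)
import Relation.Binary.Definitions as B
open import Relation.Binary.PropositionalEquality
  using (_≡_; _≢_; refl; sym; trans; cong; cong₂; subst; setoid; ≢-sym; module ≡-Reasoning)
open import Relation.Nullary using (¬_; does; yes; no; contradiction; ¬?; _×-dec_)
open import Relation.Unary using (Pred; Decidable)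

-- In an acyclic graph two neighbours of v joined by a walk avoiding v are equal.
-- Hence, rooting a tree at zero, every other vertex has exactly one neighbour from which
-- the root is reached without returning, so the arcs number 2 (n - 1).  For the same reason
-- non-backtracking walks are simple, so each arc leaving a vertex of degree ≢ 2 begins exactly
-- one oriented segment, and the degrees ≢ 2 add up to 2 k.  Together with
--   d² + 2 [d = 3] + 4 = 4 d + [d ≠ 2] d   and   6 [d = 4] + 4 [d = 3] + 2 = d + [d ≠ 2] d
-- for 1 ≤ d ≤ 4 these two counts give M₁ + 2 n₃ + 8 = 4 n + 2 k and k = 1 + 2 n₃ + 3 n₄;
-- the latter fixes n₃ modulo 3, hence its least possible value.

-- Lists: reversal, two-element lists, and equal lengths from equal membership.

module _ {A : Set} where

  reverse-unique : {xs : List A} → Unique xs → Unique (reverse xs)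
  reverse-unique {xs} = Unique-resp-↭ (setoid A) (↭⇒↭ₛ (↭-sym (↭-reverse xs)))

  module _ {R : Rel A 0ℓ} where

    ∷ʳ-linked : ∀ xs {x y} → Linked R (xs ∷ʳ x) → R x y → Linked R (xs ∷ʳ x ∷ʳ y)
    ∷ʳ-linked []           [-]     r = r ∷ [-]
    ∷ʳ-linked (_ ∷ [])     (s ∷ l) r = s ∷ ∷ʳ-linked [] l r
    ∷ʳ-linked (_ ∷ z ∷ zs) (s ∷ l) r = s ∷ ∷ʳ-linked (z ∷ zs) l r

    reverse-linked : B.Symmetric R → {xs : List A} → Linked R xs → Linked R (reverse xs)
    reverse-linked sy []  = []
    reverse-linked sy [-] = [-]
    reverse-linked sy {x ∷ y ∷ xs} (r ∷ l) =
      subst (Linked R) (sym (unfold-reverse x (y ∷ xs)))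
        (subst (λ zs → Linked R (zs ∷ʳ x)) (sym (unfold-reverse y xs))
          (∷ʳ-linked (reverse xs) (subst (Linked R) (unfold-reverse y xs) (reverse-linked sy l)) (sy r)))

  reverse-∷-∷ʳ : ∀ x (xs : List A) y → reverse (x ∷ (xs ∷ʳ y)) ≡ y ∷ (reverse xs ∷ʳ x)
  reverse-∷-∷ʳ x xs y = trans (unfold-reverse x (xs ∷ʳ y)) (cong (_∷ʳ x) (reverse-++ xs (y ∷ [])))

  length>0 : {x : A} {xs : List A} → x ∈ xs → 1 ≤ length xs
  length>0 (here _)  = s≤s z≤n
  length>0 (there _) = s≤s z≤n

  -- Applied to the neighbours of a vertex of degree 2, this picks the way on for a walk that
  -- arrives from `p`.
  otherMember : B.DecidableEquality A → {xs : List A} → Unique xs → length xs ≡ 2 → ∀ p →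
                ∃[ y ] y ∈ xs × y ≢ p
  otherMember _≟ᴬ_ {x ∷ y ∷ []} ((x≢y ∷ _) ∷ _) _ p with x ≟ᴬ p
  ... | yes refl = y , there (here refl) , ≢-sym x≢y
  ... | no x≢p   = x , here refl , x≢p

  otherMember-unique : {xs : List A} → length xs ≡ 2 → ∀ {p y z} → p ∈ xs → y ∈ xs → z ∈ xs →
                       y ≢ p → z ≢ p → y ≡ z
  otherMember-unique {_ ∷ _ ∷ []} _ (here refl) (here refl) _ y≢p _ = ⊥-elim (y≢p refl)
  otherMember-unique {_ ∷ _ ∷ []} _ (here refl) (there (here refl)) (here refl) _ z≢p = ⊥-elim (z≢p refl)
  otherMember-unique {_ ∷ _ ∷ []} _ (here refl) (there (here refl)) (there (here refl)) _ _ = refl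
  otherMember-unique {_ ∷ _ ∷ []} _ (there (here refl)) (there (here refl)) _ y≢p _ = ⊥-elim (y≢p refl)
  otherMember-unique {_ ∷ _ ∷ []} _ (there (here refl)) (here refl) (here refl) _ _ = refl
  otherMember-unique {_ ∷ _ ∷ []} _ (there (here refl)) (here refl) (there (here refl)) _ z≢p = ⊥-elim (z≢p refl)

  unique∧set⇒length≡ : {xs ys : List A} → Unique xs → Unique ys →
                       (∀ {z} → z ∈ xs → z ∈ ys) → (∀ {z} → z ∈ ys → z ∈ xs) → length xs ≡ length ys
  unique∧set⇒length≡ xs! ys! ⊆ ⊇ = ↭-length (∼bag⇒↭ (unique∧set⇒bag xs! ys! (mk⇔ ⊆ ⊇)))

-- Counting by bijective enumeration.

-- `f` is a bijection from the enumerated indices onto the elements satisfying `P`, so its image and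
-- the filtered list are duplicate-free with the same members.
length-filter-image : {I A : Set} {is : List I} {xs : List A} {P : Pred A 0ℓ} (P? : Decidable P) →
                      Unique is → Unique xs → (∀ i → i ∈ is) → (∀ x → x ∈ xs) →
                      (f : I → A) → (∀ {i j} → f i ≡ f j → i ≡ j) →
                      (∀ i → P (f i)) → (∀ {x} → P x → ∃[ i ] f i ≡ x) →
                      length (filter P? xs) ≡ length is
length-filter-image {is = is} {xs} P? is! xs! ∈is ∈xs f f-inj Pf f-onto = begin
  length (filter P? xs)
    ≡⟨ unique∧set⇒length≡ (Unique.filter⁺ P? xs!) (Unique.map⁺ f-inj is!) into (back ∘ ∈-map⁻ f) ⟩
  length (map f is)      ≡⟨ length-map f is ⟩
  length is              ∎
  where
  open ≡-Reasoning
  into : ∀ {x} → x ∈ filter P? xs → x ∈ map f is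
  into x∈ with i , refl ← f-onto (proj₂ (∈-filter⁻ P? {xs = xs} x∈)) = ∈-map⁺ f (∈is i)
  back : ∀ {x} → ∃[ i ] i ∈ is × x ≡ f i → x ∈ filter P? xs
  back (i , _ , refl) = ∈-filter⁺ P? (∈xs _) (Pf i)

length-filter-map : {A B : Set} {P : Pred B 0ℓ} (P? : Decidable P) (f : A → B) (xs : List A) →
                    length (filter P? (map f xs)) ≡ length (filter (P? ∘ f) xs)
length-filter-map P? f []       = refl
length-filter-map P? f (x ∷ xs) with does (P? (f x))
... | true  = cong suc (length-filter-map P? f xs)
... | false = length-filter-map P? f xs

module _ {A B : Set} where

  length-cartesianProduct : (xs : List A) (ys : List B) →
                            length (cartesianProduct xs ys) ≡ length xs * length ys
  length-cartesianProduct []       ys = refl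
  length-cartesianProduct (x ∷ xs) ys =
    trans (length-++ (map (x ,_) ys)) (cong₂ _+_ (length-map (x ,_) ys) (length-cartesianProduct xs ys))

  length-filter-cartesianProduct :
    {P : Pred (A × B) 0ℓ} (P? : Decidable P) (xs : List A) (ys : List B) →
    length (filter P? (cartesianProduct xs ys)) ≡
    sum (map (λ x → length (filter (λ y → P? (x , y)) ys)) xs)
  length-filter-cartesianProduct P? []       ys = refl
  length-filter-cartesianProduct P? (x ∷ xs) ys = begin
    length (filter P? (map (x ,_) ys ++ cartesianProduct xs ys))
      ≡⟨ cong length (filter-++ P? (map (x ,_) ys) _) ⟩
    length (filter P? (map (x ,_) ys) ++ filter P? (cartesianProduct xs ys))
      ≡⟨ length-++ (filter P? (map (x ,_) ys)) ⟩
    length (filter P? (map (x ,_) ys)) + length (filter P? (cartesianProduct xs ys))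
      ≡⟨ cong₂ _+_ (length-filter-map P? (x ,_) ys) (length-filter-cartesianProduct P? xs ys) ⟩
    _ ∎
    where open ≡-Reasoning

-- Serves both double counts of ordered pairs: `Fin m` indexes the unoriented objects (edges or
-- segments) and `Fin 2` their two directions.
sum-double-enumeration :
  ∀ {m n} {P : Pred (Fin n × Fin n) 0ℓ} (P? : Decidable P) (f : Fin 2 × Fin m → Fin n × Fin n) →
  (∀ {i j} → f i ≡ f j → i ≡ j) → (∀ i → P (f i)) → (∀ {x} → P x → ∃[ i ] f i ≡ x) →
  sum (map (λ u → length (filter (λ v → P? (u , v)) (allFin n))) (allFin n)) ≡ 2 * m
sum-double-enumeration {m} {n} P? f f-inj Pf f-onto = begin
  _  ≡⟨ length-filter-cartesianProduct P? (allFin n) (allFin n) ⟨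
  _  ≡⟨ length-filter-image P? (pairs! 2 m) (pairs! n n) ∈pairs ∈pairs f f-inj Pf f-onto ⟩
  _  ≡⟨ length-cartesianProduct (allFin 2) (allFin m) ⟩
  _  ≡⟨ cong (2 *_) (length-tabulate {n = m} (λ i → i)) ⟩
  2 * m ∎
  where
  open ≡-Reasoning
  pairs! : ∀ a b → Unique (cartesianProduct (allFin a) (allFin b))
  pairs! a b = Unique.cartesianProduct⁺ (Unique.allFin⁺ a) (Unique.allFin⁺ b)
  ∈pairs : ∀ {a b} (x : Fin a × Fin b) → x ∈ cartesianProduct (allFin a) (allFin b)
  ∈pairs (i , j) = ∈-cartesianProduct⁺ (∈-allFin i) (∈-allFin j)

unique⇒length≤ : ∀ {n} {xs : List (Fin n)} → Unique xs → length xs ≤ n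
unique⇒length≤ {n} {xs} xs! = begin
  length xs                            ≡⟨ unique∧set⇒length≡ xs! (Unique.filter⁺ (_∈? xs) (Unique.allFin⁺ n))
                                            (∈-filter⁺ (_∈? xs) (∈-allFin _))
                                            (proj₂ ∘ ∈-filter⁻ (_∈? xs) {xs = allFin n}) ⟩
  length (filter (_∈? xs) (allFin n))  ≤⟨ length-filter (_∈? xs) (allFin n) ⟩
  length (allFin n)                    ≡⟨ length-tabulate {n = n} (λ i → i) ⟩
  n                                    ∎
  where
  open ≤-Reasoning
  open import Data.List.Membership.DecPropositional (Fin._≟_ {n}) using (_∈?_)

-- The number of oriented segments that begin at a vertex of degree `d` in a tree: one along each
-- incident edge, but none at degree 2.
zeroAt2 : ℕ → ℕ
zeroAt2 2 = 0
zeroAt2 d = d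

zeroAt2-≢2 : ∀ {d} → d ≢ 2 → zeroAt2 d ≡ d
zeroAt2-≢2 {0}                 _   = refl
zeroAt2-≢2 {1}                 _   = refl
zeroAt2-≢2 {2}                 d≢2 = ⊥-elim (d≢2 refl)
zeroAt2-≢2 {suc (suc (suc _))} _   = refl

distinctVertex : ∀ {m} → 1 ≤ m → (v : Fin (suc m)) → ∃[ u ] u ≢ v
distinctVertex (s≤s _) zero    = suc zero , λ ()
distinctVertex _       (suc _) = zero , λ ()

-- Neighbours and walks avoiding a vertex.

module _ {n : ℕ} (G : Graph n) where
  open Graph G
  open import Data.List.Membership.DecPropositional (Fin._≟_ {n}) using (_∈?_)

  neighbours : Fin n → List (Fin n)
  neighbours v = filter (v ~?_) (allFin n)

  ∈-neighbours : ∀ {v w} → v ~ w → w ∈ neighbours v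
  ∈-neighbours v~w = ∈-filter⁺ (_ ~?_) (∈-allFin _) v~w

  ∈-neighbours⁻ : ∀ {v w} → w ∈ neighbours v → v ~ w
  ∈-neighbours⁻ {v} w∈ = proj₂ (∈-filter⁻ (v ~?_) {xs = allFin n} w∈)

  neighbours-unique : ∀ v → Unique (neighbours v)
  neighbours-unique v = Unique.filter⁺ (v ~?_) (Unique.allFin⁺ n)

  -- Excluding `v` at both ends makes the steps reversible. The empty walk at `v` still belongs to
  -- `Avoiding v`.
  AvoidingStep : Fin n → Rel (Fin n) 0ℓ
  AvoidingStep v x y = x ~ y × x ≢ v × y ≢ v

  Avoiding : Fin n → Rel (Fin n) 0ℓ
  Avoiding v = Star (AvoidingStep v)

  avoiding-sym : ∀ {v} → B.Symmetric (Avoiding v)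
  avoiding-sym = Star.reverse (λ (x~y , x≢v , y≢v) → ~-sym x~y , y≢v , x≢v)

  avoiding-end : ∀ {v x} → x ≢ v → ¬ Avoiding v x v
  avoiding-end x≢v ε                   = x≢v refl
  avoiding-end _   ((_ , _ , y≢v) ◅ w) = avoiding-end y≢v w

  linked⇒avoiding : ∀ {v x z} {xs : List (Fin n)} → Linked _~_ (x ∷ xs) → All (v ≢_) (x ∷ xs) →
                    z ∈ x ∷ xs → Avoiding v x z
  linked⇒avoiding _         _                  (here refl) = ε
  linked⇒avoiding (x~y ∷ l) (v≢x ∷ v≢y ∷ v≢ys) (there z∈) =
    (x~y , ≢-sym v≢x , ≢-sym v≢y) ◅ linked⇒avoiding l (v≢y ∷ v≢ys) z∈

  -- The vertices after the first are listed in the last index; v is avoided.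
  data SimplePath (v : Fin n) : Fin n → Fin n → List (Fin n) → Set where
    []   : ∀ {x} → SimplePath v x x []
    cons : ∀ {x y z ys} → x ~ y → x ∉ y ∷ ys → x ≢ v → SimplePath v y z ys → SimplePath v x z (y ∷ ys)

  loopErase-from : ∀ {v x y z ys} → SimplePath v y z ys → x ∈ y ∷ ys → ∃[ xs ] SimplePath v x z xs
  loopErase-from p              (here refl) = _ , p
  loopErase-from (cons _ _ _ p) (there x∈)  = loopErase-from p x∈

  -- If the new first vertex already lies on the erased path, the part before that occurrence is
  -- dropped.
  loopErase : ∀ {v x z} → Avoiding v x z → ∃[ xs ] SimplePath v x z xs
  loopErase ε = _ , []
  loopErase {x = x} (_◅_ {j = y} (x~y , x≢v , _) w) with ys , p ← loopErase w with x ∈? (y ∷ ys)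
  ... | yes x∈ = loopErase-from p x∈
  ... | no x∉  = _ , cons x~y x∉ x≢v p

  -- The constructors keep `v` away from every vertex but the last, which `z ≢ v` covers. Prepending
  -- `v` prepares for closing the path to a cycle.
  simplePath-unique : ∀ {v x z xs} → SimplePath v x z xs → z ≢ v → Unique (v ∷ x ∷ xs)
  simplePath-unique []                z≢v = (≢-sym z≢v ∷ []) ∷ [] ∷ []
  simplePath-unique (cons _ x∉ x≢v p) z≢v with v∉ ∷ u ← simplePath-unique p z≢v =
    (≢-sym x≢v ∷ v∉) ∷ ¬Any⇒All¬ _ x∉ ∷ u

  simplePath-linked : ∀ {v x z xs} → SimplePath v x z xs → z ~ v → Linked _~_ (x ∷ (xs ∷ʳ v))
  simplePath-linked []               z~v = z~v ∷ [-]
  simplePath-linked (cons x~y _ _ p) z~v = x~y ∷ simplePath-linked p z~v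

  ~⇒≢ : ∀ {x y} → x ~ y → x ≢ y
  ~⇒≢ x~y x≡y = ~-irrefl x≡y x~y

  -- After its last visit to `u` a walk avoids `u`. The relation `T` is kept general so that the
  -- step leaving `u` retains its own restrictions: it is used for `_~_` and for `AvoidingStep`.
  lastExit : ∀ {T : Rel (Fin n) 0ℓ} → T ⇒ _~_ → ∀ u {x r} → u ≢ r → Star T x r →
             (x ≢ u × Avoiding u x r) ⊎ ∃[ w ] T u w × Avoiding u w r
  lastExit T⇒~ u u≢r ε = inj₁ (≢-sym u≢r , ε)
  lastExit T⇒~ u {x} u≢r (x↝y ◅ w) with lastExit T⇒~ u u≢r w
  ... | inj₂ exit = inj₂ exit
  ... | inj₁ (y≢u , a) with x Fin.≟ u
  ...   | yes refl = inj₂ (_ , x↝y , a)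
  ...   | no x≢u   = inj₁ (x≢u , (T⇒~ x↝y , x≢u , y≢u) ◅ a)

  lastExit-self : ∀ {T : Rel (Fin n) 0ℓ} → T ⇒ _~_ → ∀ {u r} → u ≢ r → Star T u r →
                  ∃[ w ] T u w × Avoiding u w r
  lastExit-self T⇒~ u≢r w with lastExit T⇒~ _ u≢r w
  ... | inj₁ (u≢u , _) = ⊥-elim (u≢u refl)
  ... | inj₂ exit      = exit

  -- The walk is cut at its first visit to `v`, if there is one.
  reaches-or-avoids : ∀ {u x r} v → Avoiding u x r → Avoiding u x v ⊎ (x ≢ v × Avoiding v x r)
  reaches-or-avoids {x = x} v w with x Fin.≟ v
  reaches-or-avoids v w | yes refl = inj₁ ε
  reaches-or-avoids v ε | no x≢v = inj₂ (x≢v , ε)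
  reaches-or-avoids v (s@(x~y , _) ◅ w) | no x≢v with reaches-or-avoids v w
  ... | inj₁ a         = inj₁ (s ◅ a)
  ... | inj₂ (y≢v , a) = inj₂ (x≢v , (x~y , x≢v , y≢v) ◅ a)

  -- Non-backtracking walks and trails along segments.

  -- The walk x ∷ xs, entered by the edge from p to x.
  data NonBacktracking : Fin n → Fin n → List (Fin n) → Set where
    []   : ∀ {p x} → NonBacktracking p x []
    cons : ∀ {p x y ys} → x ~ y → y ≢ p → NonBacktracking x y ys → NonBacktracking p x (y ∷ ys)

  nonBacktracking-linked : ∀ {p x xs} → NonBacktracking p x xs → Linked _~_ (x ∷ xs)
  nonBacktracking-linked []              = [-]
  nonBacktracking-linked (cons x~y _ nb) = x~y ∷ nonBacktracking-linked nb

  -- Trail p x xs follows the segment through p and x, from x to its end.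
  data Trail : Fin n → Fin n → List (Fin n) → Set where
    stop : ∀ {p x} → degree G x ≢ 2 → Trail p x []
    step : ∀ {p x y ys} → degree G x ≡ 2 → x ~ y → y ≢ p → Trail x y ys → Trail p x (y ∷ ys)

  trail⇒nonBacktracking : ∀ {p x xs} → Trail p x xs → NonBacktracking p x xs
  trail⇒nonBacktracking (stop _)           = []
  trail⇒nonBacktracking (step _ x~y y≢p t) = cons x~y y≢p (trail⇒nonBacktracking t)

  -- The degree of `x` decides whether to stop, and at degree 2 only one neighbour differs from `p`.
  trail-deterministic : ∀ {p x xs ys} → p ~ x → Trail p x xs → Trail p x ys → xs ≡ ys
  trail-deterministic p~x (stop _)     (stop _)     = refl
  trail-deterministic p~x (stop d≢2)   (step d≡2 _ _ _) = ⊥-elim (d≢2 d≡2)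
  trail-deterministic p~x (step d≡2 _ _ _) (stop d≢2)   = ⊥-elim (d≢2 d≡2)
  trail-deterministic p~x (step d≡2 x~y y≢p t) (step _ x~z z≢p t′)
    with refl ← otherMember-unique d≡2 (∈-neighbours (~-sym p~x)) (∈-neighbours x~y) (∈-neighbours x~z)
                                      y≢p z≢p
    = cong (_ ∷_) (trail-deterministic x~y t t′)

  -- `m` bounds the number of steps, so the recursion is structural; acyclicity later excludes the
  -- second outcome for `m = n`.
  trail-or-long : ∀ m p x → (∃[ xs ] Trail p x xs) ⊎ (∃[ xs ] NonBacktracking p x xs × length xs ≡ m)
  trail-or-long zero    p x = inj₂ ([] , [] , refl)
  trail-or-long (suc m) p x with degree G x ≟ 2
  ... | no d≢2  = inj₁ ([] , stop d≢2)
  ... | yes d≡2 with y , y∈ , y≢p ← otherMember Fin._≟_ (neighbours-unique x) d≡2 p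
                with trail-or-long m x y
  ...   | inj₁ (ys , t)       = inj₁ (y ∷ ys , step d≡2 (∈-neighbours⁻ y∈) y≢p t)
  ...   | inj₂ (ys , nb , eq) = inj₂ (y ∷ ys , cons (∈-neighbours⁻ y∈) y≢p nb , cong suc eq)

  trail-last : ∀ {p x xs} → Trail p x xs →
               ∃₂ λ is e → x ∷ xs ≡ is ∷ʳ e × All (λ v → degree G v ≡ 2) is × degree G e ≢ 2
  trail-last (stop d≢2) = [] , _ , refl , [] , d≢2
  trail-last (step d≡2 _ _ t) with is , e , eq , ds , d≢2 ← trail-last t =
    _ ∷ is , e , cong (_ ∷_) eq , d≡2 ∷ ds , d≢2

  -- A path has no repeated vertex, so it never turns back to the vertex it came from.
  path⇒trail : ∀ {p} is {e} → All (λ v → degree G v ≡ 2) is → degree G e ≢ 2 →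
               IsPath G (p ∷ (is ∷ʳ e)) → ∃₂ λ x xs → is ∷ʳ e ≡ x ∷ xs × p ~ x × Trail p x xs
  path⇒trail []       []       d≢2 (p~x ∷ _ , _) = _ , [] , refl , p~x , stop d≢2
  path⇒trail (x ∷ is) (d ∷ ds) d≢2 (p~x ∷ l , (_ ∷ p∉) ∷ u)
    with y , ys , eq , x~y , t ← path⇒trail is ds d≢2 (l , u) =
    x , _ , refl , p~x ,
    subst (Trail _ x) (sym eq) (step d x~y (≢-sym (All.head (subst (All _) eq p∉))) t)

  -- Oriented segments and their initial arcs.

  open Segment

  -- Indexed by the vertex list instead of the segment, so that the equation for `vs` can be matched
  -- with `refl` and arcs are compared through the lists on which `_≈ˢ_` depends.
  InitialArc : List (Fin n) → Set
  InitialArc vs = Σ[ (v , w) ∈ Fin n × Fin n ] Σ[ xs ∈ List (Fin n) ]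
                  vs ≡ v ∷ w ∷ xs × v ~ w × degree G v ≢ 2 × Trail v w xs

  initialArc : (S : Segment G) → InitialArc (vertices S)
  initialArc S with x , xs , eq , s~x , t ← path⇒trail (internal S) (internal≡2 S) (end≢2 S) (isPath S) =
    (start S , x) , xs , cong (start S ∷_) eq , s~x , start≢2 S , t

  arc : Segment G → Fin n × Fin n
  arc S = proj₁ (initialArc S)

  initialArc-unique : ∀ {vs v w xs} (a : InitialArc vs) → vs ≡ v ∷ w ∷ xs → proj₁ a ≡ (v , w)
  initialArc-unique (_ , _ , refl , _) refl = refl

  -- Only one trail continues a given arc, so the first two vertices fix all the others.
  initialArc-determines : ∀ {vs vs′} (a : InitialArc vs) (a′ : InitialArc vs′) →
                          proj₁ a ≡ proj₁ a′ → vs ≡ vs′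
  initialArc-determines (_ , _ , refl , v~w , _ , t) (_ , _ , refl , _ , _ , t′) refl =
    cong (λ xs → _ ∷ _ ∷ xs) (trail-deterministic v~w t t′)

  flip : Segment G → Segment G
  flip S = record
    { start = end S ; internal = reverse (internal S) ; end = start S
    ; isPath = subst (IsPath G) (reverse-∷-∷ʳ (start S) (internal S) (end S))
        (reverse-linked ~-sym (proj₁ (isPath S)) , reverse-unique (proj₂ (isPath S)))
    ; start≢2 = end≢2 S ; end≢2 = start≢2 S
    ; internal≡2 = All-resp-↭ (↭-sym (↭-reverse (internal S))) (internal≡2 S) }

  vertices-flip : ∀ S → vertices (flip S) ≡ reverse (vertices S)
  vertices-flip S = sym (reverse-∷-∷ʳ (start S) (internal S) (end S))

  -- Otherwise start and end would coincide, though they are separate entries of a repetition-free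
  -- list. Hence the two directions of a segment are counted separately.
  vertices-not-palindrome : ∀ S → vertices S ≢ vertices (flip S)
  vertices-not-palindrome S eq with start∉ ∷ _ ← proj₂ (isPath S) =
    All¬⇒¬Any start∉ (subst (_∈ internal S ∷ʳ end S) (sym (∷-injectiveˡ eq)) (last∈ (internal S)))
    where
    last∈ : ∀ {e} (xs : List (Fin n)) → e ∈ xs ∷ʳ e
    last∈ []       = here refl
    last∈ (_ ∷ xs) = there (last∈ xs)

  orient : Fin 2 → Segment G → Segment G
  orient zero       S = S
  orient (suc zero) S = flip S

  -- Consequences of acyclicity and the count of oriented segments.

  module _ (acyclic : Acyclic G) where

    -- If `p` and `q` differ, loop erasure gives a simple path between them off `v`, and `v` closes
    -- it to a cycle.
    neighbours-separated : ∀ {v p q} → v ~ p → v ~ q → Avoiding v p q → p ≡ q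
    neighbours-separated {v} {p} {q} v~p v~q w with loopErase w
    ... | [] , [] = refl
    ... | y ∷ ys , path =
      ⊥-elim (acyclic v (p ∷ y ∷ ys)
        ( s≤s (s≤s z≤n)
        , simplePath-unique path (≢-sym (~⇒≢ v~q))
        , v~p ∷ simplePath-linked path (~-sym v~q)))

    -- Rooted at r, the parent of u is its neighbour v with Avoiding u v r.
    edge-one-way : ∀ {r u v} → u ~ v → Avoiding u v r → ¬ Avoiding v u r
    edge-one-way {r} {u} {v} u~v a b with u Fin.≟ r
    ... | yes refl = avoiding-end (≢-sym (~⇒≢ u~v)) a
    ... | no u≢r with w , (u~w , _ , w≢v) , c ← lastExit-self proj₁ u≢r b =
      w≢v (neighbours-separated u~w u~v (c ◅◅ avoiding-sym a))

    -- Let `w` follow the last visit to `u` on a walk from `u` to `r`. If the rest meets `v`, then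
    -- `w ≡ v` by separation; if not, the rest preceded by `u` avoids `v`. With `edge-one-way`,
    -- every edge joins a child to its parent in exactly one direction.
    edge-some-way : ∀ {r u v} → Connected G → u ~ v → Avoiding u v r ⊎ Avoiding v u r
    edge-some-way {r} {u} {v} connected u~v with u Fin.≟ r
    ... | yes refl = inj₂ ε
    ... | no u≢r with w , u~w , a ← lastExit-self (λ e → e) u≢r (connected u r) with reaches-or-avoids v a
    ...   | inj₁ b with refl ← neighbours-separated u~w u~v b = inj₁ a
    ...   | inj₂ (w≢v , b) = inj₂ ((u~w , ~⇒≢ u~v , w≢v) ◅ b)

    -- By induction the walk does not return to `x`. If it met `p`, it would join the neighbours `y`
    -- and `p` of `x` off `x`, forcing `y ≡ p`.
    nonBacktracking-unique : ∀ {p x xs} → p ~ x → NonBacktracking p x xs → Unique (p ∷ x ∷ xs)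
    nonBacktracking-unique p~x [] = (~⇒≢ p~x ∷ []) ∷ [] ∷ []
    nonBacktracking-unique {p} {x} p~x (cons {y = y} {ys} x~y y≢p nb)
      with x∉ ∷ u ← nonBacktracking-unique x~y nb =
      (~⇒≢ p~x ∷ ¬Any⇒All¬ (y ∷ ys) p∉) ∷ x∉ ∷ u
      where
      p∉ : p ∉ y ∷ ys
      p∉ p∈ = y≢p (neighbours-separated x~y (~-sym p~x)
        (linked⇒avoiding (nonBacktracking-linked nb) x∉ p∈))

    trail : ∀ {p x} → p ~ x → ∃[ xs ] Trail p x xs
    -- A non-backtracking walk of `n` steps from `x` would visit `n + 1` distinct vertices.
    trail {p} {x} p~x with trail-or-long n p x
    ... | inj₁ t = t
    ... | inj₂ (xs , nb , eq) with _ ∷ u ← nonBacktracking-unique p~x nb =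
      ⊥-elim (n≮n n (subst (_< n) eq (unique⇒length≤ u)))

    segmentFrom : ∀ {v w} → v ~ w → degree G v ≢ 2 → Σ[ S ∈ Segment G ] ∃[ xs ] vertices S ≡ v ∷ w ∷ xs
    segmentFrom {v} {w} v~w dv≢2 with xs , t ← trail v~w with is , e , eq , ds , de≢2 ← trail-last t =
      record
        { start = v ; internal = is ; end = e
        ; isPath = subst (IsPath G) (cong (v ∷_) eq)
            (v~w ∷ nonBacktracking-linked nb , nonBacktracking-unique v~w nb)
        ; start≢2 = dv≢2 ; end≢2 = de≢2 ; internal≡2 = ds }
      , xs , cong (v ∷_) (sym eq)
      where nb = trail⇒nonBacktracking t

    -- The arcs leaving vertices of degree other than 2 are counted by their first vertex, and again
    -- by the segment and direction they begin.
    sum-degree-≢2 : ∀ {k} → HasSegments G k →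
                    sum (map (zeroAt2 ∘ degree G) (allFin n)) ≡ 2 * k
    sum-degree-≢2 {k} segs = begin
      _ ≡⟨ cong sum (map-cong outDegree (allFin n)) ⟩
      _ ≡⟨ sum-double-enumeration P? f f-inj Pf f-onto ⟩
      2 * k ∎
      where
      open ≡-Reasoning
      open Inverse segs using (to; from; inverseˡ; inverseʳ)
      P : Pred (Fin n × Fin n) 0ℓ
      P (v , w) = v ~ w × degree G v ≢ 2
      P? : Decidable P
      P? (v , w) = (v ~? w) ×-dec ¬? (degree G v ≟ 2)

      outDegree : ∀ v → zeroAt2 (degree G v) ≡ length (filter (λ w → P? (v , w)) (allFin n))
      outDegree v = case degree G v ≟ 2 of λ where
        (yes d≡2) → trans (cong zeroAt2 d≡2) (sym (cong length
          (filter-none (λ w → P? (v , w)) (All.universal (λ _ p → proj₂ p d≡2) (allFin n)))))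
        (no d≢2)  → trans (zeroAt2-≢2 d≢2) (cong length
          (filter-≐ (v ~?_) (λ w → P? (v , w)) ((λ v~w → v~w , d≢2) , proj₁) (allFin n)))

      f : Fin 2 × Fin k → Fin n × Fin n
      f (b , i) = arc (orient b (to i))

      to-injective : ∀ {i j} → _≈ˢ_ G (to i) (to j) → i ≡ j
      to-injective {i} {j} eq = trans (sym (inverseʳ {i} {to i} (inj₁ refl))) (inverseʳ {j} {to i} eq)

      orient-injective : ∀ b c {i j} → vertices (orient b (to i)) ≡ vertices (orient c (to j)) →
                         (b , i) ≡ (c , j)
      orient-injective zero zero eq = cong (zero ,_) (to-injective (inj₁ eq))
      -- Opposite directions: the two segments are equivalent, so the indices agree and the vertex
      -- list would equal its own reversal.
      orient-injective zero (suc zero) {i} {j} eq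
        with refl ← to-injective {i} {j} (inj₂ (trans eq (vertices-flip (to j)))) =
        ⊥-elim (vertices-not-palindrome (to i) eq)
      orient-injective (suc zero) zero {i} {j} eq
        with refl ← to-injective {j} {i} (inj₂ (trans (sym eq) (vertices-flip (to i)))) =
        ⊥-elim (vertices-not-palindrome (to i) (sym eq))
      orient-injective (suc zero) (suc zero) {i} {j} eq =
        cong (suc zero ,_) (to-injective (inj₁ (reverse-injective
          (trans (sym (vertices-flip (to i))) (trans eq (vertices-flip (to j)))))))

      f-inj : ∀ {i j} → f i ≡ f j → i ≡ j
      f-inj {b , i} {c , j} eq = orient-injective b c
        (initialArc-determines (initialArc (orient b (to i))) (initialArc (orient c (to j))) eq)

      Pf : ∀ i → P (f i)
      Pf (b , i) = let _ , _ , _ , v~w , d≢2 , _ = initialArc (orient b (to i)) in v~w , d≢2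

      f-onto : ∀ {a} → P a → ∃[ i ] f i ≡ a
      -- The enumeration returns `S` only up to reversal, and this decides the direction.
      f-onto (v~w , d≢2) with S , xs , eq ← segmentFrom v~w d≢2 with inverseˡ {S} refl
      ... | inj₁ same = (zero , from S) , initialArc-unique (initialArc (to (from S))) (trans same eq)
      ... | inj₂ rev  = (suc zero , from S) , initialArc-unique (initialArc (flip (to (from S))))
              (trans (vertices-flip (to (from S)))
                (trans (cong reverse rev) (trans (reverse-involutive (vertices S)) eq)))

-- Degree sum of a tree rooted at `zero`.

module _ {m : ℕ} (G : Graph (suc m)) (tree : IsTree G) where
  open Graph G
  open IsTree tree

  -- The vertices other than the root are the `suc i`, so `Fin m` indexes the edges by their child.
  parent : (i : Fin m) → ∃[ v ] suc i ~ v × Avoiding G (suc i) v zero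
  parent i = lastExit-self G (λ e → e) (λ ()) (connected (suc i) zero)

  -- `f` lists each edge from child to parent and back.
  sum-degree : sum (map (degree G) (allFin (suc m))) ≡ 2 * m
  sum-degree = sum-double-enumeration (λ (u , v) → u ~? v) f f-inj f-edge f-onto
    where
    f : Fin 2 × Fin m → Fin (suc m) × Fin (suc m)
    f (zero     , i) = suc i , proj₁ (parent i)
    f (suc zero , i) = proj₁ (parent i) , suc i

    not-mutual : ∀ i j → suc i ≡ proj₁ (parent j) → proj₁ (parent i) ≢ suc j
    not-mutual i j eq eq′ with parent i | parent j
    ... | _ , i~v , a | _ , _ , b with refl ← eq | refl ← eq′ = edge-one-way G acyclic i~v a b

    f-inj : ∀ {i j} → f i ≡ f j → i ≡ j
    f-inj {zero , i} {zero , j} eq = cong (zero ,_) (Fin.suc-injective (,-injectiveˡ eq))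
    f-inj {zero , i} {suc zero , j} eq = ⊥-elim (not-mutual i j (,-injectiveˡ eq) (,-injectiveʳ eq))
    f-inj {suc zero , i} {zero , j} eq = ⊥-elim (not-mutual i j (,-injectiveʳ eq) (,-injectiveˡ eq))
    f-inj {suc zero , i} {suc zero , j} eq = cong (suc zero ,_) (Fin.suc-injective (,-injectiveʳ eq))

    f-edge : ∀ i → proj₁ (f i) ~ proj₂ (f i)
    f-edge (zero , i)     = proj₁ (proj₂ (parent i))
    f-edge (suc zero , i) = ~-sym (proj₁ (proj₂ (parent i)))

    parent-unique : ∀ {u v} → u ~ v → Avoiding G u v zero → ∃[ i ] u ≡ suc i × proj₁ (parent i) ≡ v
    parent-unique {zero}  u~v a = ⊥-elim (avoiding-end G (≢-sym (~⇒≢ G u~v)) a)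
    parent-unique {suc i} u~v a with w , u~w , b ← parent i in eq =
      i , refl , trans (cong proj₁ eq) (neighbours-separated G acyclic u~w u~v (b ◅◅ avoiding-sym G a))

    f-onto : ∀ {a} → proj₁ a ~ proj₂ a → ∃[ i ] f i ≡ a
    f-onto u~v with edge-some-way G acyclic connected u~v
    ... | inj₁ a with i , refl , refl ← parent-unique u~v a         = (zero , i) , refl
    ... | inj₂ a with i , refl , refl ← parent-unique (~-sym u~v) a = (suc zero , i) , refl

  -- Excludes degree 0, where the pointwise degree identities fail.
  degree≥1 : 1 ≤ m → ∀ v → 1 ≤ degree G v
  degree≥1 1≤m v with u , u≢v ← distinctVertex 1≤m v with connected v u
  ... | ε       = ⊥-elim (u≢v refl)
  ... | v~w ◅ _ = length>0 (∈-neighbours G v~w)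

-- Sums over lists and the two degree identities.

module _ {A : Set} where

  length-filter≡sum : {P : Pred A 0ℓ} (P? : Decidable P) (xs : List A) →
                      length (filter P? xs) ≡ sum (map (λ x → if does (P? x) then 1 else 0) xs)
  length-filter≡sum P? []       = refl
  length-filter≡sum P? (x ∷ xs) with does (P? x)
  ... | true  = cong suc (length-filter≡sum P? xs)
  ... | false = length-filter≡sum P? xs

  sum-map-+ : (f g : A → ℕ) (xs : List A) →
              sum (map (λ x → f x + g x) xs) ≡ sum (map f xs) + sum (map g xs)
  sum-map-+ f g []       = refl
  sum-map-+ f g (x ∷ xs) = trans (cong (f x + g x +_) (sum-map-+ f g xs)) (interchange (f x) (g x) _ _)
    where
    interchange : ∀ a b c d → a + b + (c + d) ≡ a + c + (b + d)
    interchange = solve-∀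

  sum-map-* : (c : ℕ) (f : A → ℕ) (xs : List A) → sum (map (λ x → c * f x) xs) ≡ c * sum (map f xs)
  sum-map-* c f []       = sym (*-zeroʳ c)
  sum-map-* c f (x ∷ xs) = trans (cong (c * f x +_) (sum-map-* c f xs)) (sym (*-distribˡ-+ c (f x) _))

  sum-map-const : (c : ℕ) (xs : List A) → sum (map (λ _ → c) xs) ≡ c * length xs
  sum-map-const c []       = sym (*-zeroʳ c)
  sum-map-const c (x ∷ xs) = trans (cong (c +_) (sum-map-const c xs)) (sym (*-suc c (length xs)))

  module _ (d : A → ℕ) (xs : List A) (1≤d : ∀ x → 1 ≤ d x) (d≤4 : ∀ x → d x ≤ 4) where

    private
      count : ℕ → ℕ
      count e = length (filter (λ x → d x ≟ e) xs)
      [d≡_] : ℕ → A → ℕ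
      [d≡ e ] x = if does (d x ≟ e) then 1 else 0
      Σ[d] Σ[d²] Σ[d≢2] : ℕ
      Σ[d]   = sum (map d xs)
      Σ[d²]  = sum (map (λ x → d x ^ 2) xs)
      Σ[d≢2] = sum (map (zeroAt2 ∘ d) xs)

    -- The polynomial (d - 1)(d - 4) = d² - 5d + 4 vanishes at 1 and 4 and is -2 at 2 and 3. The
    -- term with `count 3` corrects the value at 3, and `zeroAt2` the value at 2.
    squareSum-identity : Σ[d²] + 2 * count 3 + 4 * length xs ≡ 4 * Σ[d] + Σ[d≢2]
    squareSum-identity = begin
      Σ[d²] + 2 * count 3 + 4 * length xs
        ≡⟨ cong₂ (λ c l → Σ[d²] + 2 * c + l)
             (length-filter≡sum (λ x → d x ≟ 3) xs) (sym (sum-map-const 4 xs)) ⟩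
      Σ[d²] + 2 * sum (map [d≡ 3 ] xs) + sum (map (λ _ → 4) xs)
        ≡⟨ cong (λ s → Σ[d²] + s + _) (sum-map-* 2 [d≡ 3 ] xs) ⟨
      Σ[d²] + sum (map (λ x → 2 * [d≡ 3 ] x) xs) + sum (map (λ _ → 4) xs)
        ≡⟨ cong (_+ _) (sum-map-+ (λ x → d x ^ 2) (λ x → 2 * [d≡ 3 ] x) xs) ⟨
      sum (map (λ x → d x ^ 2 + 2 * [d≡ 3 ] x) xs) + sum (map (λ _ → 4) xs)
        ≡⟨ sum-map-+ (λ x → d x ^ 2 + 2 * [d≡ 3 ] x) (λ _ → 4) xs ⟨
      sum (map (λ x → d x ^ 2 + 2 * [d≡ 3 ] x + 4) xs)
        ≡⟨ cong sum (map-cong pointwise xs) ⟩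
      sum (map (λ x → 4 * d x + zeroAt2 (d x)) xs)
        ≡⟨ sum-map-+ (λ x → 4 * d x) (zeroAt2 ∘ d) xs ⟩
      sum (map (λ x → 4 * d x) xs) + Σ[d≢2]
        ≡⟨ cong (_+ Σ[d≢2]) (sum-map-* 4 d xs) ⟩
      4 * Σ[d] + Σ[d≢2] ∎
      where
      open ≡-Reasoning
      pointwise : ∀ x → d x ^ 2 + 2 * [d≡ 3 ] x + 4 ≡ 4 * d x + zeroAt2 (d x)
      pointwise x with d x | 1≤d x | d≤4 x
      ... | 1 | _ | _ = refl
      ... | 2 | _ | _ = refl
      ... | 3 | _ | _ = refl
      ... | 4 | _ | _ = refl
      ... | suc (suc (suc (suc (suc _)))) | _ | s≤s (s≤s (s≤s (s≤s ())))

    -- d + `zeroAt2 d` - 2 is 0 at 1 and 2, 4 at 3, and 6 at 4.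
    branching-identity : 6 * count 4 + 4 * count 3 + 2 * length xs ≡ Σ[d] + Σ[d≢2]
    branching-identity = begin
      6 * count 4 + 4 * count 3 + 2 * length xs
        ≡⟨ cong₂ (λ b c → 6 * b + 4 * c + 2 * length xs)
             (length-filter≡sum (λ x → d x ≟ 4) xs) (length-filter≡sum (λ x → d x ≟ 3) xs) ⟩
      6 * sum (map [d≡ 4 ] xs) + 4 * sum (map [d≡ 3 ] xs) + 2 * length xs
        ≡⟨ cong₂ _+_ (cong₂ _+_ (sum-map-* 6 [d≡ 4 ] xs) (sum-map-* 4 [d≡ 3 ] xs)) (sum-map-const 2 xs) ⟨
      sum (map (λ x → 6 * [d≡ 4 ] x) xs) + sum (map (λ x → 4 * [d≡ 3 ] x) xs) + sum (map (λ _ → 2) xs)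
        ≡⟨ cong (_+ _) (sum-map-+ (λ x → 6 * [d≡ 4 ] x) (λ x → 4 * [d≡ 3 ] x) xs) ⟨
      sum (map (λ x → 6 * [d≡ 4 ] x + 4 * [d≡ 3 ] x) xs) + sum (map (λ _ → 2) xs)
        ≡⟨ sum-map-+ (λ x → 6 * [d≡ 4 ] x + 4 * [d≡ 3 ] x) (λ _ → 2) xs ⟨
      sum (map (λ x → 6 * [d≡ 4 ] x + 4 * [d≡ 3 ] x + 2) xs)
        ≡⟨ cong sum (map-cong pointwise xs) ⟩
      sum (map (λ x → d x + zeroAt2 (d x)) xs)
        ≡⟨ sum-map-+ d (zeroAt2 ∘ d) xs ⟩
      Σ[d] + Σ[d≢2] ∎
      where
      open ≡-Reasoning
      pointwise : ∀ x → 6 * [d≡ 4 ] x + 4 * [d≡ 3 ] x + 2 ≡ d x + zeroAt2 (d x)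
      pointwise x with d x | 1≤d x | d≤4 x
      ... | 1 | _ | _ = refl
      ... | 2 | _ | _ = refl
      ... | 3 | _ | _ = refl
      ... | 4 | _ | _ = refl
      ... | suc (suc (suc (suc (suc _)))) | _ | s≤s (s≤s (s≤s (s≤s ())))

-- The two identities for a chemical tree with `k` segments.

module _ {m k : ℕ} (1≤m : 1 ≤ m) (T : CT (suc m) k) where
  open CT T
  open IsChemicalTree isChemicalTree
  open ≡-Reasoning

  private
    V = allFin (suc m)

    |V| : length V ≡ suc m
    |V| = length-tabulate {n = suc m} (λ i → i)

    n₃ n₄ : ℕ
    n₃ = numDegree graph 3
    n₄ = numDegree graph 4

    Σ[d]≡ : sum (map (degree graph) V) ≡ 2 * m
    Σ[d]≡ = sum-degree graph isTree

    Σ[d≢2]≡ : sum (map (zeroAt2 ∘ degree graph) V) ≡ 2 * k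
    Σ[d≢2]≡ = sum-degree-≢2 graph (IsTree.acyclic isTree) hasSegments

  -- The degree sums `2 * m` and `2 * k` are put into `squareSum-identity`; adding and cancelling
  -- `4 * m` avoids subtraction.
  M₁-identity : M₁ graph + (2 * n₃ + 8) ≡ 4 * suc m + 2 * k
  M₁-identity = +-cancelʳ-≡ (4 * m) _ _ (begin
    M₁ graph + (2 * n₃ + 8) + 4 * m        ≡⟨ regroupˡ (M₁ graph) n₃ m ⟩
    M₁ graph + 2 * n₃ + 4 * suc m + 4      ≡⟨ cong (λ l → M₁ graph + 2 * n₃ + 4 * l + 4) |V| ⟨
    M₁ graph + 2 * n₃ + 4 * length V + 4
      ≡⟨ cong (_+ 4) (squareSum-identity (degree graph) V (degree≥1 graph isTree 1≤m) degree≤4) ⟩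
    4 * sum (map (degree graph) V) + sum (map (zeroAt2 ∘ degree graph) V) + 4
      ≡⟨ cong₂ (λ s t → 4 * s + t + 4) Σ[d]≡ Σ[d≢2]≡ ⟩
    4 * (2 * m) + 2 * k + 4                ≡⟨ regroupʳ m k ⟩
    4 * suc m + 2 * k + 4 * m              ∎)
    where
    regroupˡ : ∀ a b m → a + (2 * b + 8) + 4 * m ≡ a + 2 * b + 4 * suc m + 4
    regroupˡ = solve-∀
    regroupʳ : ∀ m k → 4 * (2 * m) + 2 * k + 4 ≡ 4 * suc m + 2 * k + 4 * m
    regroupʳ = solve-∀

  segment-identity : k ≡ 1 + 2 * n₃ + n₄ * 3
  segment-identity = sym (*-cancelˡ-≡ _ _ 2 (+-cancelʳ-≡ (2 * m) _ _ (begin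
    2 * (1 + 2 * n₃ + n₄ * 3) + 2 * m      ≡⟨ regroup n₃ n₄ m ⟩
    6 * n₄ + 4 * n₃ + 2 * suc m            ≡⟨ cong (λ l → 6 * n₄ + 4 * n₃ + 2 * l) |V| ⟨
    6 * n₄ + 4 * n₃ + 2 * length V
      ≡⟨ branching-identity (degree graph) V (degree≥1 graph isTree 1≤m) degree≤4 ⟩
    sum (map (degree graph) V) + sum (map (zeroAt2 ∘ degree graph) V)
      ≡⟨ cong₂ _+_ Σ[d]≡ Σ[d≢2]≡ ⟩
    2 * m + 2 * k                          ≡⟨ +-comm (2 * m) (2 * k) ⟩
    2 * k + 2 * m                          ∎)))
    where
    regroup : ∀ b c m → 2 * (1 + 2 * b + c * 3) + 2 * m ≡ 6 * c + 4 * b + 2 * suc m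
    regroup = solve-∀

  segments-mod-3 : k % 3 ≡ (1 + 2 * n₃) % 3
  segments-mod-3 = trans (cong (_% 3) segment-identity) ([m+kn]%n≡m%n (1 + 2 * n₃) n₄ 3)

-- From the identities to the bounds.

-- Writing y = r + e, the bound exceeds `x` by exactly 2e, so equality means e = 0. The truncated
-- subtraction is exact, since `t` is at least `2 * r + 8`.
bound-with-equality : ∀ {x y t} r → x + (2 * y + 8) ≡ t → r ≤ y →
                      x ≤ t ∸ (2 * r + 8) × (x ≡ t ∸ (2 * r + 8) ⇔ y ≡ r)
bound-with-equality {x} {y} r refl r≤y with e , refl ← m≤n⇒∃[o]m+o≡n r≤y =
  subst (λ b → x ≤ b × (x ≡ b ⇔ r + e ≡ r)) (sym bound) (m≤m+n x (2 * e) , mk⇔ to from)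
  where
  bound : x + (2 * (r + e) + 8) ∸ (2 * r + 8) ≡ x + 2 * e
  bound = trans (cong (_∸ (2 * r + 8)) (regroup x r e)) (m+n∸n≡m (x + 2 * e) (2 * r + 8))
    where
    regroup : ∀ x r e → x + (2 * (r + e) + 8) ≡ x + 2 * e + (2 * r + 8)
    regroup = solve-∀
  to : x ≡ x + 2 * e → r + e ≡ r
  to eq = trans (cong (r +_) e≡0) (+-identityʳ r)
    where
    e≡0 : e ≡ 0
    e≡0 = m+n≡0⇒m≡0 e (sym (+-cancelˡ-≡ x 0 (2 * e) (trans (+-identityʳ x) eq)))
  from : r + e ≡ r → x ≡ x + 2 * e
  from eq = trans (sym (+-identityʳ x)) (cong (λ z → x + 2 * z) (sym e≡0))
    where
    e≡0 : e ≡ 0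
    e≡0 = +-cancelˡ-≡ r e 0 (trans eq (sym (+-identityʳ r)))

theorem1 : ∀ (n k : ℕ) → 3 ≤ k → k ≤ n ∸ 1 → (T : CT n k) →
    let G = CT.graph T in
    (k % 3 ≡ 0 → M₁ G ≤ 4 * n + 2 * k ∸ 10 × (M₁ G ≡ 4 * n + 2 * k ∸ 10 ⇔ numDegree G 3 ≡ 1)) ×
    (k % 3 ≡ 1 → M₁ G ≤ 4 * n + 2 * k ∸ 8 × (M₁ G ≡ 4 * n + 2 * k ∸ 8 ⇔ numDegree G 3 ≡ 0)) ×
    (k % 3 ≡ 2 → M₁ G ≤ 4 * n + 2 * k ∸ 12 × (M₁ G ≡ 4 * n + 2 * k ∸ 12 ⇔ numDegree G 3 ≡ 2))
theorem1 zero    k 3≤k k≤0 T = contradiction (≤-trans 3≤k k≤0) λ ()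
theorem1 (suc m) k 3≤k k≤m T =
  -- For each residue of `k`, the least `c` with 1 + 2c congruent to `k` modulo 3 is 1, 0 or 2, and
  -- `2 * r + 8` becomes 10, 8 or 12.
  (λ k≡0 → bound 1 (n₃≥1 (numDegree graph 3) (trans (sym mod) k≡0))) ,
  (λ _   → bound 0 z≤n) ,
  (λ k≡2 → bound 2 (n₃≥2 (numDegree graph 3) (trans (sym mod) k≡2)))
  where
  open CT T
  1≤m : 1 ≤ m
  1≤m = ≤-trans (s≤s z≤n) (≤-trans 3≤k k≤m)
  mod : k % 3 ≡ (1 + 2 * numDegree graph 3) % 3
  mod = segments-mod-3 1≤m T
  bound : ∀ r → r ≤ numDegree graph 3 →
          let b = 4 * suc m + 2 * k ∸ (2 * r + 8) in
          M₁ graph ≤ b × (M₁ graph ≡ b ⇔ numDegree graph 3 ≡ r)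
  bound r = bound-with-equality {M₁ graph} r (M₁-identity 1≤m T)
  -- The missing cases are refuted by computation: `c = 0` leaves residue 1, and `c = 1` leaves
  -- residue 0.
  n₃≥1 : ∀ c → (1 + 2 * c) % 3 ≡ 0 → 1 ≤ c
  n₃≥1 (suc _) _ = s≤s z≤n
  n₃≥2 : ∀ c → (1 + 2 * c) % 3 ≡ 2 → 2 ≤ c
  n₃≥2 (suc (suc _)) _ = s≤s (s≤s z≤n)
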